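{- $6 \leq \chi_p(\mathcal{G}^{\rm c}_{3}) \leq \chi_p(\mathcal{G}_{3}) \leq 7$.
   Context: An oriented graph is a loopless directed graph without opposite arcs (an orientation $\overrightarrow{G}$ of a simple undirected graph $G$). Pushing a vertex $v$ means reversing the orientation of every arc incident with $v$. Two oriented graphs are in a push relationship if one can be obtained from the other by pushing some set of vertices. A homomorphism $\overrightarrow{G}\to\overrightarrow{H}$ is a vertex map sending each arc $uv$ to an arc $\phi(u)\phi(v)$. A pushable homomorphism from $\overrightarrow{G}$ to $\overrightarrow{H}$ is a map that is a homomorphism from some oriented graph in a push relationship with $\overrightarrow{G}$ to $\overrightarrow{H}$. The pushable chromatic number $\chi_p(\overrightarrow{G})$ is the minimum number of vertices of an oriented graph $\overrightarrow{H}$ admitting a pushable homomorphism from $\overrightarrow{G}$. For an undirected graph $G$, $\chi_p(G)=\max\chi_p(\overrightarrow{G})$ over all orientations of $G$; for a family $\mathcal{F}$, $\chi_p(\mathcal{F})=\max_{G\in\mathcal{F}}\chi_p(G)$. $\mathcal{G}_{3}$ is the family of graphs with maximum degree $3$, and $\mathcal{G}^{\rm c}_{3}$ is the family of connected graphs with maximum degree $3$. -}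

module Defs where

open import Data.Nat using (ℕ; _≤_; pred)
open import Data.Fin using (Fin)
open import Data.Bool using (Bool; true; false; _∨_; _xor_; if_then_else_)
open import Data.List using (List; map; allFin)
open import Data.Nat.ListAction using (sum)
open import Data.Product using (Σ; ∃; _×_)
open import Relation.Binary.PropositionalEquality using (_≡_)
open import Relation.Nullary using (¬_)

record Graph (n : ℕ) : Set where
  field
    adj    : Fin n → Fin n → Bool
    irrefl : ∀ v → adj v v ≡ false
    sym    : ∀ u v → adj u v ≡ adj v u
open Graph public

record OrientedGraph (n : ℕ) : Set where
  field
    arc      : Fin n → Fin n → Bool
    loopless : ∀ v → arc v v ≡ false
    noOpp    : ∀ u v → arc u v ≡ true → arc v u ≡ false
open OrientedGraph public

IsOrientation : ∀ {n} → Graph n → OrientedGraph n → Set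
IsOrientation G D = ∀ u v → adj G u v ≡ (arc D u v ∨ arc D v u)

degree : ∀ {n} → Graph n → Fin n → ℕ
degree {n} G v = sum (map (λ u → if adj G v u then 1 else 0) (allFin n))

MaxDegreeAtMost : ∀ {n} → Graph n → ℕ → Set
MaxDegreeAtMost G d = ∀ v → degree G v ≤ d

MaxDegree : ∀ {n} → Graph n → ℕ → Set
MaxDegree G d = MaxDegreeAtMost G d × ∃ λ v → degree G v ≡ d

data Walk {n : ℕ} (G : Graph n) : Fin n → Fin n → Set where
  here : ∀ {v} → Walk G v v
  step : ∀ {u w v} → adj G u w ≡ true → Walk G w v → Walk G u v

Connected : ∀ {n} → Graph n → Set
Connected G = ∀ u v → Walk G u v

-- Arc relation obtained by pushing the vertex set S (S v = true iff v is pushed):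
-- an arc is reversed iff exactly one of its ends is pushed.
pushArc : ∀ {n} → (Fin n → Bool) → (Fin n → Fin n → Bool) → Fin n → Fin n → Bool
pushArc S a u v = if S u xor S v then a v u else a u v

IsHom : ∀ {n m} → (Fin n → Fin n → Bool) → OrientedGraph m → (Fin n → Fin m) → Set
IsHom a H φ = ∀ u v → a u v ≡ true → arc H (φ u) (φ v) ≡ true

IsPushableHom : ∀ {n m} → OrientedGraph n → OrientedGraph m → (Fin n → Fin m) → Set
IsPushableHom {n} D H φ = ∃ λ (S : Fin n → Bool) → IsHom (pushArc S (arc D)) H φ

PushChiAtMost : ∀ {n} → OrientedGraph n → ℕ → Set
PushChiAtMost {n} D k =
  ∃ λ m → m ≤ k × Σ (OrientedGraph m) λ H → ∃ λ (φ : Fin n → Fin m) → IsPushableHom D H φ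

GraphPushChiAtMost : ∀ {n} → Graph n → ℕ → Set
GraphPushChiAtMost G k = ∀ D → IsOrientation G D → PushChiAtMost D k

GraphPushChiAtLeast : ∀ {n} → Graph n → ℕ → Set
GraphPushChiAtLeast G k = ∃ λ D → IsOrientation G D × ¬ PushChiAtMost D (pred k)

{-# OPTIONS --safe #-}
module Submission where

-- Upper bound. The target is the Paley tournament on 7 vertices; a pushable homomorphism to it is a
-- homomorphism to its antitwinned digraph on 14 colours, in which any two colours that are not antitwins
-- have at least 2 common out-neighbours. Let W be the set of uncoloured vertices, each with at most two
-- neighbours outside W. By induction on the complement of W, the complement has a proper colouring in which
-- no vertex of W sees two antitwins. A vertex v ∉ W with at most two neighbours outside W is coloured last:
-- it has more candidate colours than its neighbours in W can forbid. If there is none, the complement of W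
-- is cubic and closed under adjacency, and it contains a triangle, a 4-cycle, or an edge whose six-vertex
-- closed neighbourhood is an induced tree. In each case the whole configuration is coloured last. For the
-- tree: a leaf leaves its neighbour at least 9 of the 14 colours, so each end of the edge keeps 9 + 9 − 14 = 4
-- colours, and any 3 colours have at least 11 out-neighbours, which must meet any 4 colours.
--
-- Lower bound. In a suitable orientation of K₃,₃ no two vertices can be identified.

open import Data.Bool using (Bool; true; false; _∧_; _∨_; not; _xor_; T; if_then_else_)
import Data.Bool.Properties as Bool
open import Data.Empty using (⊥-elim)
open import Data.Fin as Fin using (Fin; zero; suc; toℕ)
open import Data.Fin.Properties using (_≟_; suc-injective; any?; all?; pigeonhole)
open import Data.Fin.Subset using (Subset; _∪_; ∁; ⁅_⁆; _⊃_) renaming (_∈_ to _∈ˢ_; _∉_ to _∉ˢ_; ⊥ to ∅)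
open import Data.Fin.Subset.Induction using (⊃-wellFounded)
open import Data.Fin.Subset.Properties using (_∈?_; ∉⊥; x∈⁅x⁆; x∈⁅y⁆⇒x≡y; x∈p∪q⁻; x∈p∪q⁺; x∉∁p⇒x∈p; x∉p⇒x∈∁p; x∈p⇒x∉∁p)
open import Data.List using (List; []; _∷_; _++_; length; map; filter; allFin; foldr; concatMap)
open import Data.List.Membership.Propositional using (_∈_; _∉_; lose)
open import Data.List.Membership.Propositional.Properties using (∈-filter⁺; ∈-filter⁻; ∈-allFin; ∈-∃++; ∈-++⁻; ∈-++⁺ˡ; ∈-++⁺ʳ; ∈-concatMap⁺; ∈-map⁺)
open import Data.List.Properties using (length-++; length-map)
open import Data.List.Relation.Unary.All as All using (All; []; _∷_)
open import Data.List.Relation.Unary.AllPairs using (AllPairs; []; _∷_)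
open import Data.List.Relation.Unary.Any using (here; there)
open import Data.List.Relation.Unary.Unique.Propositional using (Unique)
import Data.List.Relation.Unary.Unique.Propositional.Properties as Unique
open import Data.Nat as ℕ using (ℕ; zero; suc; _+_; _∸_; _≤_; _<_; _≤ᵇ_; _≤?_; _%_; s≤s; z≤n; s≤s⁻¹)
open import Data.Nat.DivMod using (_mod_)
open import Data.Nat.ListAction using (sum)
open import Data.Nat.Properties using (≤ᵇ⇒≤; ≤-refl; ≤-trans; ≤-reflexive; ≰⇒>; <⇒≱; +-mono-≤; +-monoˡ-≤; +-suc; +-comm; m≤n⇒m≤1+n; +-cancelˡ-≤; +-cancelˡ-<)
open import Data.Product using (Σ; ∃; ∃-syntax; _×_; _,_; proj₁; proj₂)
open import Data.Sum using (_⊎_; inj₁; inj₂)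
open import Data.Unit using (tt)
open import Data.Vec using (Vec; []; _∷_; lookup)
open import Function using (_∘_)
open import Induction.WellFounded using (Acc; acc)
open import Relation.Binary.PropositionalEquality using (_≡_; _≢_; refl; sym; trans; cong; subst; subst₂)
open import Relation.Nullary using (Dec; yes; no; does; ¬_; ¬?; _×-dec_; _⊎-dec_; _→-dec_)
open import Relation.Nullary.Decidable using (from-yes)
open import Defs hiding (sym)

-- Boolean predicates on Fin n

∧-true : ∀ {a b} → a ∧ b ≡ true → a ≡ true × b ≡ true
∧-true {true} {true} _ = refl , refl

∧-true₃ : ∀ {a b c} → a ∧ b ∧ c ≡ true → a ≡ true × b ≡ true × c ≡ true
∧-true₃ {true} {true} {true} _ = refl , refl , refl

∧-intro : ∀ {a b} → a ≡ true → b ≡ true → a ∧ b ≡ true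
∧-intro refl refl = refl

bit : Bool → ℕ
bit true = 1
bit false = 0

-- The Boolean tests are opaque so that they are only evaluated on closed instances.
opaque
  count : ∀ {n} → (Fin n → Bool) → ℕ
  count {zero} P = 0
  count {suc n} P = bit (P zero) + count (P ∘ suc)

  every : ∀ {n} → (Fin n → Bool) → Bool
  every {zero} P = true
  every {suc n} P = P zero ∧ every (P ∘ suc)

  some : ∀ {n} → (Fin n → Bool) → Bool
  some {zero} P = false
  some {suc n} P = P zero ∨ some (P ∘ suc)

  atLeast : ∀ {n} → ℕ → (Fin n → Bool) → Bool
  atLeast k P = k ≤ᵇ count P

  same : ∀ {n} → Fin n → Fin n → Bool
  same p q = does (p ≟ q)

  agree : Bool → Bool → Bool
  agree a b = not (a xor b)

  every-sound : ∀ {n} {P : Fin n → Bool} → every P ≡ true → ∀ i → P i ≡ true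
  every-sound h zero = proj₁ (∧-true h)
  every-sound {P = P} h (suc i) = every-sound {P = P ∘ suc} (proj₂ (∧-true {P zero} h)) i

  some-sound : ∀ {n} {P : Fin n → Bool} → some P ≡ true → ∃[ i ] P i ≡ true
  some-sound {suc n} {P} h with P zero in eq
  ... | true = zero , eq
  ... | false with some-sound {P = P ∘ suc} h
  ... | i , e = suc i , e

  some-complete : ∀ {n} {P : Fin n → Bool} i → P i ≡ true → some P ≡ true
  some-complete zero e rewrite e = refl
  some-complete {P = P} (suc i) e rewrite some-complete {P = P ∘ suc} i e = Bool.∨-zeroʳ (P zero)

  atLeast-sound : ∀ {n k} {P : Fin n → Bool} → atLeast k P ≡ true → k ≤ count P
  atLeast-sound {k = k} {P} e = ≤ᵇ⇒≤ k (count P) (subst T (sym e) tt)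

  same-sound : ∀ {n} {p q : Fin n} → same p q ≡ true → p ≡ q
  same-sound {p = p} {q} h with p ≟ q
  ... | yes e = e

  not-same-sound : ∀ {n} {p q : Fin n} → not (same p q) ≡ true → p ≢ q
  not-same-sound {p = p} {q} h e with p ≟ q
  not-same-sound () e | yes _
  ... | no ne = ne e

  same-∨ : ∀ {n} {p q : Fin n} {b} → p ≢ q → same p q ∨ b ≡ true → b ≡ true
  same-∨ {p = p} {q} ne h with p ≟ q
  ... | yes e = ⊥-elim (ne e)
  ... | no _ = h

  agree-sound : ∀ {a b} → agree a b ≡ true → a ≡ b
  agree-sound {true} {true} _ = refl
  agree-sound {false} {false} _ = refl

_∩_ : ∀ {n} → (Fin n → Bool) → (Fin n → Bool) → Fin n → Bool
(P ∩ Q) i = P i ∧ Q i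

_∖_ : ∀ {n} → (Fin n → Bool) → Fin n → Fin n → Bool
(P ∖ f) i = P i ∧ not (does (i ≟ f))

∖-sound : ∀ {n} (P : Fin n → Bool) f i → (P ∖ f) i ≡ true → P i ≡ true × i ≢ f
∖-sound P f i h with P i | i ≟ f
... | true | no ne = refl , ne

∖-complete : ∀ {n} (P : Fin n → Bool) f i → P i ≡ true → i ≢ f → (P ∖ f) i ≡ true
∖-complete P f i e ne with i ≟ f
... | yes q = ⊥-elim (ne q)
... | no _ rewrite e = refl

opaque
  unfolding count

  count-mono : ∀ {n} {P Q : Fin n → Bool} → (∀ i → P i ≡ true → Q i ≡ true) → count P ≤ count Q
  count-mono {zero} h = z≤n
  count-mono {suc n} {P} {Q} h with P zero in p | Q zero in q
  ... | true  | true  = s≤s (count-mono (h ∘ suc))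
  ... | true  | false with trans (sym q) (h zero p)
  ... | ()
  count-mono {suc n} h | false | true  = m≤n⇒m≤1+n (count-mono (h ∘ suc))
  count-mono {suc n} h | false | false = count-mono (h ∘ suc)

  -- Inclusion-exclusion, with the size of the union bounded by `n`.
  count-∩ : ∀ {n} (P Q : Fin n → Bool) → count P + count Q ≤ n + count (P ∩ Q)
  count-∩ {zero} P Q = z≤n
  count-∩ {suc n} P Q with P zero | Q zero | count-∩ (P ∘ suc) (Q ∘ suc)
  ... | true  | true  | ih = s≤s (subst₂ _≤_ (sym (+-suc _ _)) (sym (+-suc n _)) (s≤s ih))
  ... | true  | false | ih = s≤s ih
  ... | false | true  | ih = subst (_≤ suc (n + count ((P ∩ Q) ∘ suc))) (sym (+-suc _ _)) (s≤s ih)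
  ... | false | false | ih = m≤n⇒m≤1+n ih

  count-∖ : ∀ {n} (P : Fin n → Bool) f → count P ≤ suc (count (P ∖ f))
  count-∖ {suc n} P zero = +-mono-≤ (bit≤1 (P zero)) (shifted (P zero))
    where
    bit≤1 : ∀ b → bit b ≤ 1
    bit≤1 true = s≤s z≤n
    bit≤1 false = z≤n
    shifted : ∀ b → count (P ∘ suc) ≤ bit (b ∧ false) + count ((P ∖ zero) ∘ suc)
    shifted true = count-mono λ i e → ∖-complete P zero (suc i) e λ ()
    shifted false = count-mono λ i e → ∖-complete P zero (suc i) e λ ()
  count-∖ {suc n} P (suc f) with P zero | ≤-trans (count-∖ (P ∘ suc) f) (s≤s (count-mono λ i h →
      let e , ne = ∖-sound (P ∘ suc) f i h in ∖-complete P (suc f) (suc i) e (ne ∘ suc-injective)))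
  ... | true  | ih = s≤s ih
  ... | false | ih = ih

  count-witness : ∀ {n} (P : Fin n → Bool) → 0 < count P → ∃[ i ] P i ≡ true
  count-witness {suc n} P h with P zero in eq
  ... | true = zero , eq
  ... | false with count-witness (P ∘ suc) h
  ... | i , e = suc i , e

-- Each entry of `fs`, repeated or not, removes at most one element from `P`, by `count-∖`.
count-avoid : ∀ {n} (fs : List (Fin n)) (P : Fin n → Bool) → length fs < count P →
  ∃[ i ] P i ≡ true × i ∉ fs
count-avoid [] P h with count-witness P h
... | i , e = i , e , λ ()
count-avoid (f ∷ fs) P h with count-avoid fs (P ∖ f) (s≤s⁻¹ (≤-trans h (count-∖ P f)))
... | i , e , i∉ with ∖-sound P f i e
... | e′ , ne = i , e′ , λ { (here q) → ne q ; (there m) → i∉ m }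

count-meet : ∀ {n} (P Q : Fin n → Bool) → n < count P + count Q → ∃[ i ] P i ≡ true × Q i ≡ true
count-meet {n} P Q h with count-witness (P ∩ Q)
  (+-cancelˡ-≤ n 1 _ (≤-trans (≤-reflexive (+-comm n 1)) (≤-trans h (count-∩ P Q))))
... | i , e = i , ∧-true e

-- The colours

-- A colour is a vertex of the Paley tournament together with a push bit, read through ℤ₁₄ ≅ ℤ₇ × ℤ₂.
-- In these coordinates the arcs form a circulant digraph and pushing is the translation by 7.
Color : Set
Color = Fin 14

-- The even residues that are squares mod 7 and the odd residues that are non-squares mod 7.
connection : ℕ → Bool
connection 2 = true
connection 3 = true
connection 4 = true
connection 5 = true
connection 8 = true
connection 13 = true
connection _ = false

opaque
  A : Color → Color → Bool
  A p q = connection ((toℕ q + (14 ∸ toℕ p)) % 14)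

  shift : Color → Color → Color
  shift t p = (toℕ t + toℕ p) mod 14

  neg : Color → Color
  neg p = (14 ∸ toℕ p) mod 14

  anti : Color → Color
  anti p = (7 + toℕ p) mod 14

turn : Bool → Color → Color
turn true p = anti p
turn false p = p

-- The colours left for a neighbour across an edge of sign `e` when this end may choose from `S`.
image : Bool → (Color → Bool) → Color → Bool
image e S z = some λ p → S p ∧ A (turn e p) z

-- Here `y` colours an intermediate vertex whose neighbour outside the configuration presents the
-- colour `b`.
path : Color → Color → Color → Bool
path b p z = some λ y → A b y ∧ A p y ∧ A y z

-- Colours left for the third corner of a triangle whose first two corners see `a` and `b` from
-- outside. Only the edge from the first to the third corner carries a sign, `e`.
triangleEnds : Bool → Color → Color → Color → Bool
triangleEnds e a b r = some λ p → A a p ∧ A (turn e p) r ∧ path b p r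

-- The same for the corner opposite to the first one in a 4-cycle. The colour seen by the first
-- corner is normalised to `zero`, which leaves 14² instead of 14³ cases per sign to evaluate.
squareEnds : Bool → Color → Color → Color → Bool
squareEnds e b d r = some λ p → A zero p ∧ path b p r ∧ path d (turn e p) r

-- Finite verifications in the colour digraph

opaque
  unfolding count A

  anti-anti-check : (every λ p → same (anti (anti p)) p) ≡ true
  anti-anti-check = refl

  anti-≢-check : (every λ p → not (same p (anti p))) ≡ true
  anti-≢-check = refl

  A-anti-check : (every λ p → every λ q → agree (A (anti p) q) (A q p)) ≡ true
  A-anti-check = refl

  A-shift-check : (every λ t → every λ p → every λ q → agree (A (shift t p) (shift t q)) (A p q)) ≡ true
  A-shift-check = refl

  shift-neg-check : (every λ t → every λ p → same (shift t (shift (neg t) p)) p) ≡ true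
  shift-neg-check = refl

  shift-zero-check : (every λ t → same (shift t zero) t) ≡ true
  shift-zero-check = refl

  anti-shift-check : (every λ t → every λ p → same (anti (shift t p)) (shift t (anti p))) ≡ true
  anti-shift-check = refl

  neighbours≥6-check : (every λ a → atLeast 6 (A a)) ≡ true
  neighbours≥6-check = refl

  common≥2-check : (every λ a → every λ b → same a (anti b) ∨ atLeast 2 (A a ∩ A b)) ≡ true
  common≥2-check = refl

  image-common≥9-check₀ : (every λ a → every λ b → same a (anti b) ∨ atLeast 9 (image false (A a ∩ A b))) ≡ true
  image-common≥9-check₀ = refl

  image-common≥9-check₁ : (every λ a → every λ b → same a (anti b) ∨ atLeast 9 (image true (A a ∩ A b))) ≡ true
  image-common≥9-check₁ = refl

  neighbours₃≥11-check : (every λ a → every λ b → every λ c →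
    same a b ∨ same a c ∨ same b c ∨ atLeast 11 (λ z → A a z ∨ A b z ∨ A c z)) ≡ true
  neighbours₃≥11-check = refl

  triangleEnds≥9-check₀ : (every λ a → every λ b → atLeast 9 (triangleEnds false a b)) ≡ true
  triangleEnds≥9-check₀ = refl

  triangleEnds≥9-check₁ : (every λ a → every λ b → atLeast 9 (triangleEnds true a b)) ≡ true
  triangleEnds≥9-check₁ = refl

  squareEnds≥9-check₀ : (every λ b → every λ d → atLeast 9 (squareEnds false b d)) ≡ true
  squareEnds≥9-check₀ = refl

  squareEnds≥9-check₁ : (every λ b → every λ d → atLeast 9 (squareEnds true b d)) ≡ true
  squareEnds≥9-check₁ = refl

anti-anti : ∀ p → anti (anti p) ≡ p
anti-anti p = same-sound (every-sound anti-anti-check p)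

anti-≢ : ∀ p → p ≢ anti p
anti-≢ p = not-same-sound (every-sound anti-≢-check p)

A-anti : ∀ p q → A (anti p) q ≡ A q p
A-anti p q = agree-sound (every-sound (every-sound A-anti-check p) q)

A-antiʳ : ∀ p q → A p (anti q) ≡ A q p
A-antiʳ p q = trans (sym (A-anti (anti q) p)) (cong (λ x → A x p) (anti-anti q))

A-shift : ∀ t p q → A (shift t p) (shift t q) ≡ A p q
A-shift t p q = agree-sound (every-sound (every-sound (every-sound A-shift-check t) p) q)

shift-neg : ∀ t p → shift t (shift (neg t) p) ≡ p
shift-neg t p = same-sound (every-sound (every-sound shift-neg-check t) p)

shift-zero : ∀ t → shift t zero ≡ t
shift-zero t = same-sound (every-sound shift-zero-check t)

turn-shift : ∀ e t p → turn e (shift t p) ≡ shift t (turn e p)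
turn-shift true t p = same-sound (every-sound (every-sound anti-shift-check t) p)
turn-shift false t p = refl

turn-turn : ∀ e f p → turn e (turn f p) ≡ turn (e xor f) p
turn-turn true true p = anti-anti p
turn-turn true false p = refl
turn-turn false f p = refl

turn-self : ∀ e p → turn e (turn e p) ≡ p
turn-self true p = anti-anti p
turn-self false p = refl

turn-injective : ∀ e {p q} → turn e p ≡ turn e q → p ≡ q
turn-injective e {p} {q} h = trans (sym (turn-self e p)) (trans (cong (turn e) h) (turn-self e q))

A-turnʳ : ∀ e p q → A p (turn e q) ≡ A (turn e p) q
A-turnʳ true p q = trans (A-antiʳ p q) (sym (A-anti p q))
A-turnʳ false p q = refl

A-turn : ∀ e p q → A (turn e p) (turn e q) ≡ A p q
A-turn e p q = trans (A-turnʳ e _ q) (cong (λ x → A x q) (turn-self e p))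

A-turn₂ : ∀ e f p q → A (turn e p) (turn f q) ≡ A (turn (f xor e) p) q
A-turn₂ e f p q = trans (A-turnʳ f _ q) (cong (λ x → A x q) (turn-turn f e p))

neighbours≥6 : ∀ a → 6 ≤ count (A a)
neighbours≥6 a = atLeast-sound (every-sound neighbours≥6-check a)

-- Antitwins must be excluded: the out-neighbours of `anti b` are the in-neighbours of `b`, so `b`
-- and `anti b` have no common out-neighbour.
common≥2 : ∀ a b → a ≢ anti b → 2 ≤ count (A a ∩ A b)
common≥2 a b ne = atLeast-sound (same-∨ ne (every-sound (every-sound common≥2-check a) b))

-- For a leaf of the tree configuration: `a` and `b` come from its two outer neighbours, and the
-- image is what remains for the end of the central edge.
image-common≥9 : ∀ e a b → a ≢ anti b → 9 ≤ count (image e (A a ∩ A b))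
image-common≥9 false a b ne = atLeast-sound (same-∨ ne (every-sound (every-sound image-common≥9-check₀ a) b))
image-common≥9 true a b ne = atLeast-sound (same-∨ ne (every-sound (every-sound image-common≥9-check₁ a) b))

neighbours₃≥11 : ∀ a b c → a ≢ b → a ≢ c → b ≢ c → 11 ≤ count (λ z → A a z ∨ A b z ∨ A c z)
neighbours₃≥11 a b c ab ac bc = atLeast-sound (same-∨ bc (same-∨ ac (same-∨ ab
  (every-sound (every-sound (every-sound neighbours₃≥11-check a) b) c))))

-- Three distinct members of `S` stay distinct under `turn e`, so the bound for three
-- out-neighbourhoods applies.
image≥11 : ∀ e S → 3 ≤ count S → 11 ≤ count (image e S)
image≥11 e S h with count-avoid [] S (≤-trans (s≤s z≤n) h)
... | i , Si , _ with count-avoid (i ∷ []) S (≤-trans (s≤s (s≤s z≤n)) h)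
... | j , Sj , j∉ with count-avoid (i ∷ j ∷ []) S h
... | k , Sk , k∉ = ≤-trans
    (neighbours₃≥11 (turn e i) (turn e j) (turn e k)
      (λ q → j∉ (here (sym (turn-injective e q)))) (λ q → k∉ (here (sym (turn-injective e q))))
      (λ q → k∉ (there (here (sym (turn-injective e q))))))
    (count-mono sub)
  where
  sub : ∀ z → A (turn e i) z ∨ A (turn e j) z ∨ A (turn e k) z ≡ true → image e S z ≡ true
  sub z h with A (turn e i) z in p | A (turn e j) z in q | A (turn e k) z in r
  ... | true  | _     | _    = some-complete i (∧-intro Si p)
  ... | false | true  | _    = some-complete j (∧-intro Sj q)
  ... | false | false | true = some-complete k (∧-intro Sk r)

triangleEnds≥9 : ∀ e a b → 9 ≤ count (triangleEnds e a b)
triangleEnds≥9 false a b = atLeast-sound (every-sound (every-sound triangleEnds≥9-check₀ a) b)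
triangleEnds≥9 true a b = atLeast-sound (every-sound (every-sound triangleEnds≥9-check₁ a) b)

squareEnds≥9 : ∀ e b d → 9 ≤ count (squareEnds e b d)
squareEnds≥9 false b d = atLeast-sound (every-sound (every-sound squareEnds≥9-check₀ b) d)
squareEnds≥9 true b d = atLeast-sound (every-sound (every-sound squareEnds≥9-check₁ b) d)

-- Colouring a triangle, a 4-cycle and an edge under outer constraints

infix 4 _⟶_
_⟶_ : Color → Color → Set
p ⟶ q = A p q ≡ true

-- The corners receive `p`, `q`, `r`; their outer neighbours present `a`, `b`, `c`; the Booleans are
-- the signs of the three edges.
record TriangleColours (e f g : Bool) (a b c : Color) : Set where
  field
    p q r : Color
    ap : a ⟶ p
    bq : b ⟶ q
    cr : c ⟶ r
    pq : turn e p ⟶ q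
    qr : turn f q ⟶ r
    pr : turn g p ⟶ r

record SquareColours (e f g h : Bool) (a b c d : Color) : Set where
  field
    p q r s : Color
    ap : a ⟶ p
    bq : b ⟶ q
    cr : c ⟶ r
    ds : d ⟶ s
    pq : turn e p ⟶ q
    qr : turn f q ⟶ r
    ps : turn g p ⟶ s
    sr : turn h s ⟶ r

triangle-normal : ∀ e a b c → TriangleColours false false e a b c
triangle-normal e a b c
  -- The two sets meet because 9 + 6 = 15 exceeds the 14 colours.
  with count-meet (triangleEnds e a b) (A c) (+-mono-≤ (triangleEnds≥9 e a b) (neighbours≥6 c))
... | r , h , cr with some-sound h
... | p , h′ with ∧-true₃ {A a p} h′
... | ap , pr , h″ with some-sound h″
... | q , g with ∧-true₃ {A b q} g
... | bq , pq , qr = record { p = p ; q = q ; r = r ; ap = ap ; bq = bq ; cr = cr ; pq = pq ; qr = qr ; pr = pr }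

-- Pushing the second and third vertices makes the first two edges sign-free.
opaque
  triangle-colours : ∀ e f g a b c → TriangleColours e f g a b c
  triangle-colours e f g a b c = record
    { p = p ; q = turn e q ; r = turn k r
    ; ap = ap ; bq = trans (A-turnʳ e b q) bq ; cr = trans (A-turnʳ k c r) cr
    ; pq = trans (A-turn e p q) pq
    ; qr = trans (cong (λ x → A x (turn k r)) (turn-turn f e q)) (trans (A-turn k q r) qr)
    ; pr = trans (A-turn₂ g k p r) pr }
    where
    k : Bool
    k = f xor e
    open TriangleColours (triangle-normal (k xor g) a (turn e b) (turn k c))

square-normal : ∀ e b c d → SquareColours false false e false zero b c d
square-normal e b c d
  with count-meet (squareEnds e b d) (A c) (+-mono-≤ (squareEnds≥9 e b d) (neighbours≥6 c))
... | r , h , cr with some-sound h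
... | p , h′ with ∧-true₃ {A zero p} h′
... | ap , h₁ , h₂ with some-sound h₁ | some-sound h₂
... | q , g₁ | s , g₂ with ∧-true₃ {A b q} g₁ | ∧-true₃ {A d s} g₂
... | bq , pq , qr | ds , ps , sr = record
  { p = p ; q = q ; r = r ; s = s ; ap = ap ; bq = bq ; cr = cr ; ds = ds ; pq = pq ; qr = qr ; ps = ps ; sr = sr }

-- Translation by `a` is an automorphism that commutes with `turn`, so it carries the solution for
-- `zero` to one for `a`.
square-shifted : ∀ e a b c d → SquareColours false false e false a b c d
square-shifted e a b c d = record
  { p = shift a p ; q = shift a q ; r = shift a r ; s = shift a s
  ; ap = move (shift-zero a) ap ; bq = move (shift-neg a b) bq
  ; cr = move (shift-neg a c) cr ; ds = move (shift-neg a d) ds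
  ; pq = move refl pq ; qr = move refl qr ; ps = move (sym (turn-shift e a p)) ps ; sr = move refl sr }
  where
  open SquareColours (square-normal e (shift (neg a) b) (shift (neg a) c) (shift (neg a) d))
  move : ∀ {x y z} → shift a x ≡ y → x ⟶ z → y ⟶ shift a z
  move {x} {z = z} refl h = trans (A-shift a x z) h

opaque
  -- Pushing the last three corners clears three signs. The parity of all four signs is invariant
  -- under pushing and remains as `l xor g` on the edge `ps`.
  square-colours : ∀ e f g h a b c d → SquareColours e f g h a b c d
  square-colours e f g h a b c d = record
    { p = p ; q = turn e q ; r = turn k r ; s = turn l s
    ; ap = ap ; bq = trans (A-turnʳ e b q) bq ; cr = trans (A-turnʳ k c r) cr ; ds = trans (A-turnʳ l d s) ds
    ; pq = trans (A-turn e p q) pq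
    ; qr = trans (cong (λ x → A x (turn k r)) (turn-turn f e q)) (trans (A-turn k q r) qr)
    ; ps = trans (A-turn₂ g l p s) ps
    ; sr = trans (cong (λ x → A x (turn k r)) (trans (cong (turn h) (sym (turn-turn h k s))) (turn-self h (turn k s))))
             (trans (A-turn k s r) sr) }
    where
    k : Bool
    k = f xor e
    l : Bool
    l = h xor k
    open SquareColours (square-shifted (l xor g) a (turn e b) (turn k c) (turn l d))

record EdgeColours (e : Bool) (P P′ Q Q′ : Color → Bool) : Set where
  field
    p q : Color
    Pp : P p ≡ true
    P′p : P′ p ≡ true
    Qq : Q q ≡ true
    Q′q : Q′ q ≡ true
    pq : turn e p ⟶ q

opaque
  edge-colours : ∀ e P P′ Q Q′ →
    9 ≤ count P → 9 ≤ count P′ → 9 ≤ count Q → 9 ≤ count Q′ → EdgeColours e P P′ Q Q′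
  edge-colours e P P′ Q Q′ hP hP′ hQ hQ′ = record
    { p = p ; q = q ; Pp = proj₁ Pp,P′p ; P′p = proj₂ Pp,P′p ; Qq = proj₁ Qq,Q′q ; Q′q = proj₂ Qq,Q′q
    ; pq = proj₂ (∧-true {(P ∩ P′) p} (proj₂ p-spec)) }
    where
    common≥4 : ∀ (P Q : Color → Bool) → 9 ≤ count P → 9 ≤ count Q → 4 ≤ count (P ∩ Q)
    common≥4 P Q hP hQ = +-cancelˡ-≤ 14 4 _ (≤-trans (+-mono-≤ hP hQ) (count-∩ P Q))
    3≤4 : 3 ≤ 4
    3≤4 = s≤s (s≤s (s≤s z≤n))
    q-spec : ∃[ q ] image e (P ∩ P′) q ≡ true × (Q ∩ Q′) q ≡ true
    -- Again 11 + 4 = 15 exceeds 14.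
    q-spec = count-meet (image e (P ∩ P′)) (Q ∩ Q′)
      (+-mono-≤ (image≥11 e (P ∩ P′) (≤-trans 3≤4 (common≥4 P P′ hP hP′))) (common≥4 Q Q′ hQ hQ′))
    q : Color
    q = proj₁ q-spec
    p-spec : ∃[ p ] (P ∩ P′) p ∧ A (turn e p) q ≡ true
    p-spec = some-sound (proj₁ (proj₂ q-spec))
    p : Color
    p = proj₁ p-spec
    Pp,P′p : P p ≡ true × P′ p ≡ true
    Pp,P′p = ∧-true (proj₁ (∧-true {(P ∩ P′) p} (proj₂ p-spec)))
    Qq,Q′q : Q q ≡ true × Q′ q ≡ true
    Qq,Q′q = ∧-true (proj₂ (proj₂ q-spec))

-- Lists and subsets

∈-remove : ∀ {E : Set} {x y : E} as {bs} → y ≢ x → y ∈ as ++ x ∷ bs → y ∈ as ++ bs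
∈-remove as ne h with ∈-++⁻ as h
... | inj₁ l = ∈-++⁺ˡ l
... | inj₂ (here e) = ⊥-elim (ne e)
... | inj₂ (there r) = ∈-++⁺ʳ as r

length-⊆ : ∀ {E : Set} {xs ys : List E} → Unique xs → (∀ {x} → x ∈ xs → x ∈ ys) → length xs ≤ length ys
length-⊆ [] sub = z≤n
length-⊆ {xs = x ∷ xs} (x∉ ∷ u) sub with ∈-∃++ (sub (here refl))
... | as , bs , refl = ≤-trans
    (s≤s (length-⊆ u λ h → ∈-remove as (λ e → All.lookup x∉ h (sym e)) (sub (there h))))
    (≤-reflexive (trans (cong suc (length-++ as)) (trans (sym (+-suc (length as) _)) (sym (length-++ as)))))

length-concatMap : ∀ {E F : Set} (f : E → List F) xs → (∀ {x} → x ∈ xs → length (f x) ≤ 1) →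
  length (concatMap f xs) ≤ length xs
length-concatMap f [] h = z≤n
length-concatMap f (x ∷ xs) h = ≤-trans (≤-reflexive (length-++ (f x)))
  (+-mono-≤ (h (here refl)) (length-concatMap f xs (h ∘ there)))

AllPairs-lookup : ∀ {E : Set} {R : E → E → Set} {xs x y} → AllPairs R xs → x ∈ xs → y ∈ xs →
  x ≡ y ⊎ R x y ⊎ R y x
AllPairs-lookup (r ∷ rs) (here refl) (here refl) = inj₁ refl
AllPairs-lookup (r ∷ rs) (here refl) (there j) = inj₂ (inj₁ (All.lookup r j))
AllPairs-lookup (r ∷ rs) (there i) (here refl) = inj₂ (inj₂ (All.lookup r i))
AllPairs-lookup (r ∷ rs) (there i) (there j) = AllPairs-lookup rs i j

override : ∀ {n} {C : Set} → List (Fin n × C) → (Fin n → C) → Fin n → C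
override [] c u = c u
override ((x , p) ∷ X) c u = if does (u ≟ x) then p else override X c u

override-cases : ∀ {n} {C : Set} (X : List (Fin n × C)) c u →
  ((u , override X c u) ∈ X) ⊎ (u ∉ map proj₁ X × override X c u ≡ c u)
override-cases [] c u = inj₂ ((λ ()) , refl)
override-cases ((x , p) ∷ X) c u with u ≟ x
... | yes refl = inj₁ (here refl)
... | no ne with override-cases X c u
... | inj₁ h = inj₁ (there h)
... | inj₂ (h , e) = inj₂ ((λ { (here q) → ne q ; (there m) → h m }) , e)

add : ∀ {n} → List (Fin n) → Subset n → Subset n
add xs W = foldr (λ x → ⁅ x ⁆ ∪_) W xs

add⁻ : ∀ {n} (xs : List (Fin n)) {W u} → u ∈ˢ add xs W → u ∈ xs ⊎ u ∈ˢ W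
add⁻ [] h = inj₂ h
add⁻ (x ∷ xs) h with x∈p∪q⁻ ⁅ x ⁆ _ h
... | inj₁ m = inj₁ (here (x∈⁅y⁆⇒x≡y x m))
... | inj₂ m with add⁻ xs m
... | inj₁ k = inj₁ (there k)
... | inj₂ k = inj₂ k

∉-add : ∀ {n} {xs : List (Fin n)} {W u} → u ∉ xs → u ∉ˢ W → u ∉ˢ add xs W
∉-add {xs = xs} i o m with add⁻ xs m
... | inj₁ k = i k
... | inj₂ k = o k

add⁺ˡ : ∀ {n} {xs : List (Fin n)} {W u} → u ∈ xs → u ∈ˢ add xs W
add⁺ˡ (here refl) = x∈p∪q⁺ (inj₁ (x∈⁅x⁆ _))
add⁺ˡ (there h) = x∈p∪q⁺ (inj₂ (add⁺ˡ h))

add⁺ʳ : ∀ {n} (xs : List (Fin n)) {W u} → u ∈ˢ W → u ∈ˢ add xs W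
add⁺ʳ [] h = h
add⁺ʳ (x ∷ xs) h = x∈p∪q⁺ (inj₂ (add⁺ʳ xs h))

-- Extending partial colourings

module Colouring {n} (G : Graph n) (maxDeg : MaxDegreeAtMost G 3)
                 (D : OrientedGraph n) (orient : IsOrientation G D) where

  Adj : Fin n → Fin n → Set
  Adj u v = adj G u v ≡ true

  adj-sym : ∀ {u v} → Adj u v → Adj v u
  adj-sym {u} {v} h = trans (Graph.sym G v u) h

  adj-≢ : ∀ {u v} → Adj u v → u ≢ v
  adj-≢ {u} h refl with trans (sym h) (irrefl G u)
  ... | ()

  -- `W` is the set of uncoloured vertices throughout, so these are the coloured neighbours of `v`.
  out : Subset n → Fin n → List (Fin n)
  out W v = filter (λ u → (adj G v u Bool.≟ true) ×-dec ¬? (u ∈? W)) (allFin n)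

  ∈-out⁺ : ∀ {W v u} → Adj v u → u ∉ˢ W → u ∈ out W v
  ∈-out⁺ {u = u} a h = ∈-filter⁺ _ (∈-allFin u) (a , h)

  ∈-out⁻ : ∀ {W v u} → u ∈ out W v → Adj v u × u ∉ˢ W
  ∈-out⁻ {W} {v} h = proj₂ (∈-filter⁻ (λ u → (adj G v u Bool.≟ true) ×-dec ¬? (u ∈? W)) {xs = allFin n} h)

  out-unique : ∀ W v → Unique (out W v)
  out-unique W v = Unique.filter⁺ _ (Unique.allFin⁺ n)

  out≤3 : ∀ W v → length (out W v) ≤ 3
  out≤3 W v = ≤-trans (go (allFin n)) (maxDeg v)
    where
    go : ∀ xs → length (filter (λ u → (adj G v u Bool.≟ true) ×-dec ¬? (u ∈? W)) xs)
                  ≤ sum (map (λ u → if adj G v u then 1 else 0) xs)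
    go [] = z≤n
    go (x ∷ xs) with adj G v x | x ∈? W
    ... | true  | yes _ = m≤n⇒m≤1+n (go xs)
    ... | true  | no _  = s≤s (go xs)
    ... | false | yes _ = go xs
    ... | false | no _  = go xs

  -- The source of the degree estimates: `ys` and `out W′ v` are disjoint parts of `out W v`. For
  -- `W = ∅` the right side is the full degree.
  out-split : ∀ {W W′ v} ys → Unique ys → All (λ y → Adj v y × y ∉ˢ W × y ∈ˢ W′) ys →
    (∀ {u} → u ∈ˢ W → u ∈ˢ W′) → length ys + length (out W′ v) ≤ length (out W v)
  out-split {W} {W′} {v} ys uy hy sub = ≤-trans (≤-reflexive (sym (length-++ ys)))
    (length-⊆ (Unique.++⁺ uy (out-unique W′ v) λ (m , k) → proj₂ (∈-out⁻ k) (proj₂ (proj₂ (All.lookup hy m)))) into)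
    where
    into : ∀ {u} → u ∈ ys ++ out W′ v → u ∈ out W v
    into h with ∈-++⁻ ys h
    ... | inj₁ m = let a , o , _ = All.lookup hy m in ∈-out⁺ a o
    ... | inj₂ m = let a , o = ∈-out⁻ m in ∈-out⁺ a (o ∘ sub)

  sign : Fin n → Fin n → Bool
  sign u w = not (arc D u w)

  -- Colours p of u and q of w respect the edge uw iff see u w p ⟶ q, whichever way it is oriented.
  see : Fin n → Fin n → Color → Color
  see u w = turn (sign u w)

  sign-flip : ∀ {u w} → Adj u w → sign w u ≡ not (sign u w)
  sign-flip {u} {w} h with arc D u w in e | arc D w u in f | trans (sym h) (orient u w) | noOpp D u w
  ... | true  | true  | _ | o with o refl
  ... | ()
  sign-flip h | true  | false | _ | _ = refl
  sign-flip h | false | true  | _ | _ = refl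
  sign-flip h | false | false | () | _

  -- Changing the end from which the edge is read flips the sign, and by `A-anti` flipping the sign
  -- reverses the arc.
  edge-sym : ∀ {u w p q} → Adj u w → see u w p ⟶ q → see w u q ⟶ p
  edge-sym {u} {w} {p} {q} h e rewrite sign-flip h with sign u w
  ... | true = trans (sym (A-anti p q)) e
  ... | false = trans (A-anti q p) e

  -- Only the values of `c` outside `W` are constrained. `separated` is the invariant that lets
  -- `common≥2` apply to an uncoloured vertex with two coloured neighbours.
  record Good (W : Subset n) : Set where
    field
      c : Fin n → Color
      proper : ∀ {u v} → u ∉ˢ W → v ∉ˢ W → Adj u v → see u v (c u) ⟶ c v
      separated : ∀ {w u v} → w ∈ˢ W → u ∉ˢ W → v ∉ˢ W → Adj w u → Adj w v →
        see u w (c u) ≢ anti (see v w (c v))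
  open Good

  Fits : Subset n → (Fin n → Color) → Fin n → Color → Set
  Fits W c x p = ∀ {u} → u ∉ˢ W → Adj u x → see u x (c u) ⟶ p

  -- `AllPairs` checks each edge within `X` in one order only; `edge-sym` gives the other.
  override-proper : ∀ {W} (X : List (Fin n × Color)) (g : Good (add (map proj₁ X) W)) →
    All (λ (x , p) → Fits (add (map proj₁ X) W) (c g) x p) X →
    AllPairs (λ (x , p) (y , q) → Adj x y → see x y p ⟶ q) X →
    ∀ {u v} → u ∉ˢ W → v ∉ˢ W → Adj u v → see u v (override X (c g) u) ⟶ override X (c g) v
  override-proper {W} X g fits pairs {u} {v} u∉ v∉ a
    with override-cases X (c g) u | override-cases X (c g) v
  ... | inj₁ i | inj₁ j with AllPairs-lookup pairs i j
  ... | inj₁ e = ⊥-elim (adj-≢ a (cong proj₁ e))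
  ... | inj₂ (inj₁ r) = r a
  ... | inj₂ (inj₂ r) = edge-sym (adj-sym a) (r (adj-sym a))
  override-proper X g fits pairs u∉ v∉ a | inj₁ i | inj₂ (j , e) rewrite e =
    edge-sym (adj-sym a) (All.lookup fits i (∉-add j v∉) (adj-sym a))
  override-proper X g fits pairs u∉ v∉ a | inj₂ (i , e) | inj₁ j rewrite e =
    All.lookup fits j (∉-add i u∉) a
  override-proper X g fits pairs u∉ v∉ a | inj₂ (i , e) | inj₂ (j , f) rewrite e | f =
    proper g (∉-add i u∉) (∉-add j v∉) a

  fits-out : ∀ {W} c x {p} → All (λ y → see y x (c y) ⟶ p) (out W x) → Fits W c x p
  fits-out c x h u∉ a = All.lookup h (∈-out⁺ (adj-sym a) u∉)

  fits₀ : ∀ {W} c x → length (out W x) ≤ 0 → ∀ {p} → Fits W c x p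
  fits₀ {W} c x h u∉ a with out W x | ∈-out⁺ {W} (adj-sym a) u∉
  fits₀ c x () u∉ a | _ ∷ _ | _

  fits₁ : ∀ {W} c x → length (out W x) ≤ 1 → ∃[ a ] (∀ {p} → a ⟶ p → Fits W c x p)
  fits₁ {W} c x h with out W x in eq
  -- Without coloured neighbours any colour may play the part of `a`.
  ... | [] = zero , λ _ → fits-out {W} c x (subst (All _) (sym eq) [])
  ... | y ∷ [] = see y x (c y) , λ e → fits-out {W} c x (subst (All _) (sym eq) (e ∷ []))
  fits₁ c x (s≤s ()) | _ ∷ _ ∷ _

  fits₂ : ∀ {W} (g : Good W) {x} → x ∈ˢ W → length (out W x) ≤ 2 →
    ∃[ a ] ∃[ b ] a ≢ anti b × (∀ {p} → a ⟶ p → b ⟶ p → Fits W (c g) x p)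
  fits₂ {W} g {x} x∈ h with out W x in eq
  -- With fewer than two coloured neighbours one colour is repeated, which is legitimate since no
  -- colour is its own antitwin.
  ... | [] = zero , zero , anti-≢ zero , λ _ _ → fits-out {W} (c g) x (subst (All _) (sym eq) [])
  ... | y ∷ [] = see y x (c g y) , see y x (c g y) , anti-≢ _ ,
        λ e _ → fits-out {W} (c g) x (subst (All _) (sym eq) (e ∷ []))
  ... | y ∷ z ∷ [] = see y x (c g y) , see z x (c g z)
        , separated g x∈ (proj₂ (member (here refl))) (proj₂ (member (there (here refl))))
            (proj₁ (member (here refl))) (proj₁ (member (there (here refl))))
        , λ e f → fits-out {W} (c g) x (subst (All _) (sym eq) (e ∷ f ∷ []))
    where
    member : ∀ {u} → u ∈ y ∷ z ∷ [] → Adj x u × u ∉ˢ W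
    member {u} m = ∈-out⁻ (subst (u ∈_) (sym eq) m)
  fits₂ g x∈ (s≤s (s≤s ())) | _ ∷ _ ∷ _ ∷ _

  Sparse : Subset n → Set
  Sparse W = ∀ {w} → w ∈ˢ W → length (out W w) ≤ 2

  out-add : ∀ {W v} xs → length (out (add xs W) v) ≤ length (out W v)
  out-add xs = out-split [] [] [] (add⁺ʳ xs)

  -- Enlarging `W` never adds coloured neighbours, so only the new members need a check.
  sparse-add : ∀ {W} xs → Sparse W → (∀ {x} → x ∈ xs → length (out (add xs W) x) ≤ 2) → Sparse (add xs W)
  sparse-add xs sp h w∈ with add⁻ xs w∈
  ... | inj₁ m = h m
  ... | inj₂ m = ≤-trans (out-add xs) (sp m)

  -- The neighbours of x in W forbid at most 3 − |out W x| colours, fewer than there are candidates.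
  candidates : ∀ {W} (g : Good W) {x} → x ∈ˢ W → length (out W x) ≤ 2 →
    ∃[ S ] 4 ≤ length (out W x) + count S × (∀ {p} → S p ≡ true → Fits W (c g) x p)
  candidates {W} g {x} x∈ h with out W x in eq
  ... | [] = A zero , ≤-trans 4≤6 (neighbours≥6 zero) , λ _ → fits-out {W} (c g) x (subst (All _) (sym eq) [])
    where
    4≤6 : 4 ≤ 6
    4≤6 = s≤s (s≤s (s≤s (s≤s z≤n)))
  ... | y ∷ [] = A (see y x (c g y)) , s≤s (≤-trans 3≤6 (neighbours≥6 _)) ,
        λ e → fits-out {W} (c g) x (subst (All _) (sym eq) (e ∷ []))
    where
    3≤6 : 3 ≤ 6
    3≤6 = s≤s (s≤s (s≤s z≤n))
  ... | y ∷ z ∷ [] with fits₂ g x∈ (≤-reflexive (cong length eq))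
  ... | a , b , ne , fit = A a ∩ A b , s≤s (s≤s (common≥2 a b ne)) ,
        λ {p} e → let ap , bp = ∧-true {A a p} e in fit ap bp
  candidates g x∈ (s≤s (s≤s ())) | _ ∷ _ ∷ _ ∷ _

  -- Colouring one vertex with at most two coloured neighbours

  module AddVertex {W} (sp : Sparse W) {v} (v∉ : v ∉ˢ W) (v≤2 : length (out W v) ≤ 2)
                   (g : Good (add (v ∷ []) W)) where
    W⁺ = add (v ∷ []) W

    v∈W⁺ : v ∈ˢ W⁺
    v∈W⁺ = add⁺ˡ {xs = v ∷ []} (here refl)

    -- The colours of `v` that would show `w` an antitwin of what it sees at `u`; as `see v w` is an
    -- involution, applying it solves for the colour.
    forbiddenBy : Fin n → List Color
    forbiddenBy w = map (λ u → see v w (anti (see u w (c g u)))) (out W⁺ w)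

    -- Complementing `W` makes `out` list the neighbours inside `W`.
    inner : List (Fin n)
    inner = out (∁ W) v

    forbidden : List Color
    forbidden = concatMap forbiddenBy inner

    inner⁻ : ∀ {w} → w ∈ inner → Adj v w × w ∈ˢ W
    inner⁻ h = let a , o = ∈-out⁻ h in a , x∉∁p⇒x∈p o

    -- By sparsity `w` has at most two neighbours outside `W`. One of them is `v`, so at most one
    -- `u` is left to forbid a colour.
    forbidden-length : length forbidden ≤ length inner
    forbidden-length = length-concatMap forbiddenBy inner λ {w} h →
      let a , w∈ = inner⁻ h in
      ≤-trans (≤-reflexive (length-map _ (out W⁺ w)))
        (s≤s⁻¹ (≤-trans (out-split (v ∷ []) ([] ∷ []) ((adj-sym a , v∉ , v∈W⁺) ∷ []) (add⁺ʳ (v ∷ []))) (sp w∈)))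

    degree-split : length (out W v) + length inner ≤ 3
    degree-split = ≤-trans
      -- The whole neighbourhood `out ∅ v` is split into its parts outside and inside `W`.
      (out-split {∅} (out W v) (out-unique W v)
        (All.tabulate λ m → let a , o = ∈-out⁻ m in a , ∉⊥ , x∉p⇒x∈∁p o) (⊥-elim ∘ ∉⊥))
      (out≤3 ∅ v)

    forbidden⁺ : ∀ {w u} → w ∈ˢ W → u ∉ˢ W⁺ → Adj w v → Adj w u →
      see v w (anti (see u w (c g u))) ∈ forbidden
    forbidden⁺ {w} w∈ u∉ wv wu = ∈-concatMap⁺ forbiddenBy (lose
      (∈-out⁺ (adj-sym wv) (x∈p⇒x∉∁p w∈))
      (∈-map⁺ (λ u → see v w (anti (see u w (c g u)))) (∈-out⁺ wu u∉)))

    good-with : ∀ p → Fits W⁺ (c g) v p → p ∉ forbidden → Good W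
    good-with p fit p∉ = record
      { c = c′
      ; proper = override-proper ((v , p) ∷ []) g (fit ∷ []) ([] ∷ [])
      ; separated = separate }
      where
      c′ : Fin n → Color
      c′ = override ((v , p) ∷ []) (c g)

      recolour : ∀ {u} → u ∉ˢ W → (u ≡ v × c′ u ≡ p) ⊎ (u ∉ˢ W⁺ × c′ u ≡ c g u)
      recolour {u} u∉ with override-cases ((v , p) ∷ []) (c g) u
      ... | inj₁ (here e) = inj₁ (cong proj₁ e , cong proj₂ e)
      ... | inj₂ (i , e) = inj₂ (∉-add i u∉ , e)

      conflict-free : ∀ {w u} → w ∈ˢ W → u ∉ˢ W⁺ → Adj w v → Adj w u → see v w p ≢ anti (see u w (c g u))
      conflict-free {w} w∈ u∉ wv wu e = p∉
        (subst (_∈ forbidden) (trans (cong (see v w) (sym e)) (turn-self (sign v w) p)) (forbidden⁺ w∈ u∉ wv wu))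

      separate : ∀ {w u u′} → w ∈ˢ W → u ∉ˢ W → u′ ∉ˢ W → Adj w u → Adj w u′ →
        see u w (c′ u) ≢ anti (see u′ w (c′ u′))
      separate {w} w∈ u∉ u′∉ wu wu′ e with recolour u∉ | recolour u′∉
      ... | inj₁ (refl , _)  | inj₁ (refl , _)  = anti-≢ _ e
      ... | inj₁ (refl , eq) | inj₂ (o , eq′) rewrite eq | eq′ = conflict-free w∈ o wu wu′ e
      ... | inj₂ (o , eq) | inj₁ (refl , eq′) rewrite eq | eq′ =
            conflict-free w∈ o wu′ wu (trans (sym (anti-anti _)) (cong anti (sym e)))
      ... | inj₂ (o , eq) | inj₂ (o′ , eq′) rewrite eq | eq′ =
            separated g (add⁺ʳ (v ∷ []) w∈) o o′ wu wu′ e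

    good : Good W
    good with candidates g v∈W⁺ (≤-trans (out-add (v ∷ [])) v≤2)
    -- With `o = length (out W v)`: `o + length forbidden ≤ o + length inner ≤ 3 < 4 ≤ o + count
    -- S`; cancelling `o` leaves a candidate that is not forbidden.
    ... | S , big , fit with count-avoid forbidden S (≤-trans (s≤s forbidden-length)
          (+-cancelˡ-< (length (out W v)) (length inner) (count S)
            (≤-trans (s≤s degree-split) (≤-trans big (+-monoˡ-≤ (count S) (out-add (v ∷ [])))))))
    ... | p , Sp , p∉ = good-with p (fit Sp) p∉

  -- The case where every coloured vertex has three coloured neighbours

  module Cubic {W} (dense : ∀ {v} → v ∉ˢ W → 3 ≤ length (out W v))
               (ih : ∀ xs {x} → x ∈ xs → x ∉ˢ W →
                     (∀ {y} → y ∈ xs → length (out (add xs W) y) ≤ 2) → Good (add xs W)) where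

    -- A neighbour in `W` would be a fourth neighbour of `u`.
    closed : ∀ {u v} → u ∉ˢ W → Adj u v → v ∉ˢ W
    closed {u} {v} u∉ a v∈ = <⇒≱ (dense u∉) (s≤s⁻¹ (≤-trans
      (out-split {∅} (v ∷ []) ([] ∷ []) ((a , ∉⊥ , v∈) ∷ []) (⊥-elim ∘ ∉⊥)) (out≤3 ∅ u)))

    assemble : (X : List (Fin n × Color)) (g : Good (add (map proj₁ X) W)) →
      All (λ (x , p) → Fits (add (map proj₁ X) W) (c g) x p) X →
      AllPairs (λ (x , p) (y , q) → Adj x y → see x y p ⟶ q) X → Good W
    assemble X g fits pairs = record
      { c = override X (c g)
      ; proper = override-proper X g fits pairs
      -- By `closed` no edge joins `W` to its complement, so the condition is vacuous.
      ; separated = λ w∈ u∉ _ a _ _ → closed u∉ (adj-sym a) w∈ }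

    out-bound : ∀ xs {x} ys → Unique ys → All (λ y → Adj x y × y ∉ˢ W × y ∈ xs) ys →
      length ys + length (out (add xs W) x) ≤ 3
    out-bound xs {x} ys u h = ≤-trans
      (out-split ys u (All.map (λ (a , o , m) → a , o , add⁺ˡ m) h) (add⁺ʳ xs)) (out≤3 W x)

    one-inside : ∀ xs {x y} → Adj x y → y ∉ˢ W → y ∈ xs → length (out (add xs W) x) ≤ 2
    one-inside xs a o m = s≤s⁻¹ (out-bound xs (_ ∷ []) ([] ∷ []) ((a , o , m) ∷ []))

    two-inside : ∀ xs {x y z} → x ∉ˢ W → Adj x y → Adj x z → y ≢ z → y ∈ xs → z ∈ xs →
      length (out (add xs W) x) ≤ 1
    two-inside xs x∉ a b ne m k = s≤s⁻¹ (s≤s⁻¹ (out-bound xs (_ ∷ _ ∷ []) ((ne ∷ []) ∷ [] ∷ [])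
      ((a , closed x∉ a , m) ∷ (b , closed x∉ b , k) ∷ [])))

    -- Two of the three neighbours of each corner lie in the triangle, so at most one outer colour
    -- constrains it.
    triangle : ∀ {x y z} → x ∉ˢ W → Adj x y → Adj y z → Adj x z → Good W
    triangle {x} {y} {z} x∉ xy yz xz =
      assemble ((x , p) ∷ (y , q) ∷ (z , r) ∷ []) g
        (proj₂ fx ap ∷ proj₂ fy bq ∷ proj₂ fz cr ∷ [])
        (((λ _ → pq) ∷ (λ _ → pr) ∷ []) ∷ ((λ _ → qr) ∷ []) ∷ [] ∷ [])
      where
      xs = x ∷ y ∷ z ∷ []
      y∉ = closed x∉ xy
      z∉ = closed x∉ xz
      bx : length (out (add xs W) x) ≤ 1
      bx = two-inside xs x∉ xy xz (adj-≢ yz) (there (here refl)) (there (there (here refl)))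
      by : length (out (add xs W) y) ≤ 1
      by = two-inside xs y∉ (adj-sym xy) yz (adj-≢ xz) (here refl) (there (there (here refl)))
      bz : length (out (add xs W) z) ≤ 1
      bz = two-inside xs z∉ (adj-sym xz) (adj-sym yz) (adj-≢ xy) (here refl) (there (here refl))
      g : Good (add xs W)
      g = ih xs (here refl) x∉ λ
        { (here refl) → m≤n⇒m≤1+n bx
        ; (there (here refl)) → m≤n⇒m≤1+n by
        ; (there (there (here refl))) → m≤n⇒m≤1+n bz }
      fx = fits₁ {add xs W} (c g) x bx
      fy = fits₁ {add xs W} (c g) y by
      fz = fits₁ {add xs W} (c g) z bz
      open TriangleColours (triangle-colours (sign x y) (sign y z) (sign x z) (proj₁ fx) (proj₁ fy) (proj₁ fz))

    module TriangleFree (no-triangle : ∀ {x y z} → x ∉ˢ W → Adj x y → Adj y z → ¬ Adj x z) where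

      -- A diagonal would create a triangle, so only the four sides and at most one outer colour per
      -- corner impose conditions.
      square : ∀ {x y z t} → x ∉ˢ W → Adj x y → Adj y z → Adj x t → Adj t z → x ≢ z → y ≢ t → Good W
      square {x} {y} {z} {t} x∉ xy yz xt tz x≢z y≢t =
        assemble ((x , p) ∷ (y , q) ∷ (t , s) ∷ (z , r) ∷ []) g
          (proj₂ fx ap ∷ proj₂ fy bq ∷ proj₂ ft ds ∷ proj₂ fz cr ∷ [])
          ( ((λ _ → pq) ∷ (λ _ → ps) ∷ (λ xz → ⊥-elim (no-triangle x∉ xy yz xz)) ∷ [])
          ∷ ((λ yt → ⊥-elim (no-triangle x∉ xy yt xt)) ∷ (λ _ → qr) ∷ [])
          ∷ ((λ _ → sr) ∷ []) ∷ [] ∷ [])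
        where
        xs = x ∷ y ∷ t ∷ z ∷ []
        y∉ = closed x∉ xy
        z∉ = closed y∉ yz
        t∉ = closed x∉ xt
        mx : x ∈ xs
        mx = here refl
        my : y ∈ xs
        my = there (here refl)
        mt : t ∈ xs
        mt = there (there (here refl))
        mz : z ∈ xs
        mz = there (there (there (here refl)))
        bx : length (out (add xs W) x) ≤ 1
        bx = two-inside xs x∉ xy xt y≢t my mt
        by : length (out (add xs W) y) ≤ 1
        by = two-inside xs y∉ (adj-sym xy) yz x≢z mx mz
        bt : length (out (add xs W) t) ≤ 1
        bt = two-inside xs t∉ (adj-sym xt) tz x≢z mx mz
        bz : length (out (add xs W) z) ≤ 1
        bz = two-inside xs z∉ (adj-sym yz) (adj-sym tz) y≢t my mt
        g : Good (add xs W)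
        g = ih xs mx x∉ λ
          { (here refl) → m≤n⇒m≤1+n bx
          ; (there (here refl)) → m≤n⇒m≤1+n by
          ; (there (there (here refl))) → m≤n⇒m≤1+n bt
          ; (there (there (there (here refl)))) → m≤n⇒m≤1+n bz }
        fx = fits₁ {add xs W} (c g) x bx
        fy = fits₁ {add xs W} (c g) y by
        fz = fits₁ {add xs W} (c g) z bz
        ft = fits₁ {add xs W} (c g) t bt
        open SquareColours (square-colours (sign x y) (sign y z) (sign x t) (sign t z)
          (proj₁ fx) (proj₁ fy) (proj₁ fz) (proj₁ ft))

      -- The leaf `x` is coloured after its neighbour `r`: `reach` holds colours of `r` for which
      -- some colour of `x` still works.
      record Leaf {W′} (g : Good W′) (x r : Fin n) : Set where
        constructor leaf
        field
          reach : Color → Bool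
          reach≥9 : 9 ≤ count reach
          colourable : ∀ {p} → reach p ≡ true → ∃[ k ] Fits W′ (c g) x k × see x r k ⟶ p
      open Leaf

      mkLeaf : ∀ {W′} (g : Good W′) {x r} → x ∈ˢ W′ → length (out W′ x) ≤ 2 → Leaf g x r
      mkLeaf g {x} {r} x∈ h with fits₂ g x∈ h
      ... | a , b , ne , fit = leaf (image (sign x r) (A a ∩ A b)) (image-common≥9 (sign x r) a b ne) λ {p} Rp →
            let k , e = some-sound Rp
                ab , kp = ∧-true {(A a ∩ A b) k} e
                ak , bk = ∧-true {A a k} ab
            in k , fit ak bk , kp

      two-others : ∀ {u} v → u ∉ˢ W → ∃[ a ] ∃[ b ] Adj u a × Adj u b × a ≢ b × a ≢ v × b ≢ v
      two-others {u} v u∉ with out W u | out-unique W u | dense u∉ | (λ {x} → ∈-out⁻ {W} {u} {x})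
      two-others v u∉ | [] | _ | () | _
      two-others v u∉ | _ ∷ [] | _ | s≤s () | _
      two-others v u∉ | _ ∷ _ ∷ [] | _ | s≤s (s≤s ()) | _
      two-others v u∉ | x ∷ y ∷ z ∷ _ | (x≢y ∷ x≢z ∷ _) ∷ (y≢z ∷ _) ∷ _ | _ | mem with x ≟ v | y ≟ v
      ... | yes refl | _ = y , z , proj₁ (mem (there (here refl))) , proj₁ (mem (there (there (here refl))))
            , y≢z , x≢y ∘ sym , x≢z ∘ sym
      ... | no x≢v | yes refl = x , z , proj₁ (mem (here refl)) , proj₁ (mem (there (there (here refl))))
            , x≢z , x≢y , y≢z ∘ sym
      ... | no x≢v | no y≢v = x , y , proj₁ (mem (here refl)) , proj₁ (mem (there (here refl))) , x≢y , x≢v , y≢v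

      -- The six-vertex tree: central edge `rs`, leaves `a`, `b` at `r` and `d`, `e` at `s`.
      module DoubleClaw (no-square : ∀ {x y z t} → x ∉ˢ W → Adj x y → Adj y z → Adj x t → Adj t z →
                           x ≢ z → ¬ y ≢ t)
        {r s a b d e} (r∉ : r ∉ˢ W) (rs : Adj r s)
        (ra : Adj r a) (rb : Adj r b) (a≢b : a ≢ b) (a≢s : a ≢ s) (b≢s : b ≢ s)
        (sd : Adj s d) (se : Adj s e) (d≢e : d ≢ e) (d≢r : d ≢ r) (e≢r : e ≢ r) where

        xs : List (Fin n)
        xs = a ∷ b ∷ d ∷ e ∷ r ∷ s ∷ []

        W⁺ : Subset n
        W⁺ = add xs W

        s∉ : s ∉ˢ W
        s∉ = closed r∉ rs

        ma : a ∈ xs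
        ma = here refl
        mb : b ∈ xs
        mb = there (here refl)
        md : d ∈ xs
        md = there (there (here refl))
        me : e ∈ xs
        me = there (there (there (here refl)))
        mr : r ∈ xs
        mr = there (there (there (there (here refl))))
        ms : s ∈ xs
        ms = there (there (there (there (there (here refl)))))

        out-a : length (out W⁺ a) ≤ 2
        out-a = one-inside xs (adj-sym ra) r∉ mr
        out-b : length (out W⁺ b) ≤ 2
        out-b = one-inside xs (adj-sym rb) r∉ mr
        out-d : length (out W⁺ d) ≤ 2
        out-d = one-inside xs (adj-sym sd) s∉ ms
        out-e : length (out W⁺ e) ≤ 2
        out-e = one-inside xs (adj-sym se) s∉ ms
        -- All three neighbours of `r` belong to the configuration, so no outer colour constrains
        -- `r`; likewise for `s`.
        out-r : length (out W⁺ r) ≤ 0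
        out-r = s≤s⁻¹ (s≤s⁻¹ (s≤s⁻¹ (out-bound xs (a ∷ b ∷ s ∷ []) ((a≢b ∷ a≢s ∷ []) ∷ (b≢s ∷ []) ∷ [] ∷ [])
          ((ra , closed r∉ ra , ma) ∷ (rb , closed r∉ rb , mb) ∷ (rs , s∉ , ms) ∷ []))))
        out-s : length (out W⁺ s) ≤ 0
        out-s = s≤s⁻¹ (s≤s⁻¹ (s≤s⁻¹ (out-bound xs (d ∷ e ∷ r ∷ []) ((d≢e ∷ d≢r ∷ []) ∷ (e≢r ∷ []) ∷ [] ∷ [])
          ((sd , closed s∉ sd , md) ∷ (se , closed s∉ se , me) ∷ (adj-sym rs , r∉ , mr) ∷ []))))

        g : Good W⁺
        g = ih xs mr r∉ λ
          { (here refl) → out-a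
          ; (there (here refl)) → out-b
          ; (there (there (here refl))) → out-d
          ; (there (there (there (here refl)))) → out-e
          ; (there (there (there (there (here refl))))) → ≤-trans out-r z≤n
          ; (there (there (there (there (there (here refl)))))) → ≤-trans out-s z≤n }

        -- Such an edge would close the 4-cycle `r`, `x`, `y`, `s`.
        no-cross : ∀ {x y} → Adj r x → Adj s y → x ≢ s → y ≢ r → ¬ Adj x y
        no-cross rx sy x≢s y≢r xy = no-square r∉ rx xy rs sy (y≢r ∘ sym) x≢s

        good-with : ∀ {ka kb kd ke p q} →
          Fits W⁺ (c g) a ka × see a r ka ⟶ p → Fits W⁺ (c g) b kb × see b r kb ⟶ p →
          Fits W⁺ (c g) d kd × see d s kd ⟶ q → Fits W⁺ (c g) e ke × see e s ke ⟶ q →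
          see r s p ⟶ q → Good W
        good-with {ka} {kb} {kd} {ke} {p} {q} (fa , ap) (fb , bp) (fd , dq) (fe , eq) pq =
          assemble ((a , ka) ∷ (b , kb) ∷ (d , kd) ∷ (e , ke) ∷ (r , p) ∷ (s , q) ∷ []) g
            (fa ∷ fb ∷ fd ∷ fe ∷ fits₀ (c g) r out-r ∷ fits₀ (c g) s out-s ∷ [])
            ( ( (λ ab → ⊥-elim (no-triangle r∉ ra ab rb)) ∷ (λ ad → ⊥-elim (no-cross ra sd a≢s d≢r ad))
              ∷ (λ ae → ⊥-elim (no-cross ra se a≢s e≢r ae)) ∷ (λ _ → ap)
              ∷ (λ as → ⊥-elim (no-triangle r∉ ra as rs)) ∷ [])
            ∷ ( (λ bd → ⊥-elim (no-cross rb sd b≢s d≢r bd)) ∷ (λ be → ⊥-elim (no-cross rb se b≢s e≢r be))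
              ∷ (λ _ → bp) ∷ (λ bs → ⊥-elim (no-triangle r∉ rb bs rs)) ∷ [])
            ∷ ( (λ de → ⊥-elim (no-triangle s∉ sd de se))
              ∷ (λ dr → ⊥-elim (no-triangle r∉ rs sd (adj-sym dr))) ∷ (λ _ → dq) ∷ [])
            ∷ ((λ er → ⊥-elim (no-triangle r∉ rs se (adj-sym er))) ∷ (λ _ → eq) ∷ [])
            ∷ ((λ _ → pq) ∷ []) ∷ [] ∷ [])

        combine : Leaf g a r → Leaf g b r → Leaf g d s → Leaf g e s → Good W
        combine la lb ld le = good-with
          (proj₂ (colourable la Pp)) (proj₂ (colourable lb P′p))
          (proj₂ (colourable ld Qq)) (proj₂ (colourable le Q′q)) pq
          where open EdgeColours (edge-colours (sign r s) (reach la) (reach lb) (reach ld) (reach le)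
                                   (reach≥9 la) (reach≥9 lb) (reach≥9 ld) (reach≥9 le))

        good : Good W
        good = combine (mkLeaf g (add⁺ˡ ma) out-a) (mkLeaf g (add⁺ˡ mb) out-b)
                       (mkLeaf g (add⁺ˡ md) out-d) (mkLeaf g (add⁺ˡ me) out-e)

    good : ∀ {r} → r ∉ˢ W → Good W
    good {r} r∉ with any? (λ x → any? λ y → any? λ z → ¬? (x ∈? W) ×-dec
                      (adj G x y Bool.≟ true) ×-dec (adj G y z Bool.≟ true) ×-dec (adj G x z Bool.≟ true))
    ... | yes (x , y , z , x∉ , xy , yz , xz) = triangle x∉ xy yz xz
    ... | no no-tri with any? (λ x → any? λ y → any? λ z → any? λ t → ¬? (x ∈? W) ×-dec
                      (adj G x y Bool.≟ true) ×-dec (adj G y z Bool.≟ true) ×-dec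
                      (adj G x t Bool.≟ true) ×-dec (adj G t z Bool.≟ true) ×-dec
                      ¬? (x ≟ z) ×-dec ¬? (y ≟ t))
    ... | yes (x , y , z , t , x∉ , xy , yz , xt , tz , x≢z , y≢t) =
          TriangleFree.square (λ x∉ xy yz xz → no-tri (_ , _ , _ , x∉ , xy , yz , xz)) x∉ xy yz xt tz x≢z y≢t
    ... | no no-sq = go
      where
      open TriangleFree (λ x∉ xy yz xz → no-tri (_ , _ , _ , x∉ , xy , yz , xz))
      go : Good W
      -- Any neighbour of `r` can serve as the other end `s` of the central edge.
      go with two-others r r∉
      ... | s , _ , rs , _ with two-others s r∉ | two-others r (closed r∉ rs)
      ... | a , b , ra , rb , a≢b , a≢s , b≢s | d , e , sd , se , d≢e , d≢r , e≢r =
        DoubleClaw.good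
          (λ x∉ xy yz xt tz x≢z y≢t → no-sq (_ , _ , _ , _ , x∉ , xy , yz , xt , tz , x≢z , y≢t))
          r∉ rs ra rb a≢b a≢s b≢s sd se d≢e d≢r e≢r

  -- The recursion enlarges the uncoloured set, uncolouring either one vertex or a whole
  -- configuration, until nothing is coloured.
  good-from : ∀ W → Acc _⊃_ W → Sparse W → Good W
  good-from W (acc rec) sp with any? (λ v → ¬? (v ∈? W) ×-dec (length (out W v) ≤? 2))
  ... | yes (v , v∉ , v≤2) = AddVertex.good sp v∉ v≤2
        (good-from _ (rec (add⁺ʳ (v ∷ []) , v , add⁺ˡ {xs = v ∷ []} (here refl) , v∉))
        (sparse-add (v ∷ []) sp λ { (here refl) → ≤-trans (out-add (v ∷ [])) v≤2 }))
  ... | no all-dense with any? (λ v → ¬? (v ∈? W))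
  ... | yes (r , r∉) = Cubic.good (λ v∉ → ≰⇒> λ h → all-dense (_ , v∉ , h))
        (λ xs m x∉ h → good-from (add xs W) (rec (add⁺ʳ xs , _ , add⁺ˡ m , x∉)) (sparse-add xs sp h)) r∉
  -- Base case: every vertex is uncoloured, so any colouring will do.
  ... | no full = record
        { c = λ _ → zero
        ; proper = λ u∉ _ _ → ⊥-elim (full (_ , u∉))
        ; separated = λ _ u∉ _ _ _ _ → full (_ , u∉) }

  opaque
    good-all : Good ∅
    good-all = good-from ∅ (⊃-wellFounded ∅) (⊥-elim ∘ ∉⊥)

-- The Paley tournament as a target

paley-arc : Fin 7 → Fin 7 → Bool
paley-arc x y = square? ((toℕ y + (7 ∸ toℕ x)) % 7)
  where
  square? : ℕ → Bool
  square? 1 = true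
  square? 2 = true
  square? 4 = true
  square? _ = false

paley : OrientedGraph 7
paley .arc = paley-arc
paley .loopless = from-yes (all? λ v → paley-arc v v Bool.≟ false)
paley .noOpp = from-yes (all? λ u → all? λ v → (paley-arc u v Bool.≟ true) →-dec (paley-arc v u Bool.≟ false))

vertex : Color → Fin 7
vertex p = toℕ p mod 7

-- Parity is the ℤ₂-coordinate: adding 7 keeps the residue mod 7 and changes the parity, so
-- antitwins are the two push states of one vertex.
pushed : Color → Bool
pushed p = does (toℕ p % 2 ℕ.≟ 1)

opaque
  unfolding count A

  A-paley-check : (every λ p → every λ q → not (A p q) ∨
      (if pushed p xor pushed q then paley-arc (vertex q) (vertex p) else paley-arc (vertex p) (vertex q))) ≡ true
  A-paley-check = refl

A-paley : ∀ {p q} → p ⟶ q →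
  (if pushed p xor pushed q then paley-arc (vertex q) (vertex p) else paley-arc (vertex p) (vertex q)) ≡ true
A-paley {p} {q} h with A p q | h | every-sound (every-sound A-paley-check p) q
... | true | refl | e = e

colouring-pushChi : ∀ {n} (D : OrientedGraph n) (c : Fin n → Color) →
  (∀ {u v} → arc D u v ≡ true → c u ⟶ c v) → PushChiAtMost D 7
colouring-pushChi D c c-hom = 7 , ≤-refl , paley , vertex ∘ c , pushed ∘ c , hom
  where
  hom : IsHom (pushArc (pushed ∘ c) (arc D)) paley (vertex ∘ c)
  hom u v h with pushed (c u) xor pushed (c v) in e
  ... | false = subst (λ b → (if b then paley-arc (vertex (c v)) (vertex (c u))
                                    else paley-arc (vertex (c u)) (vertex (c v))) ≡ true)
        e (A-paley (c-hom h))
  ... | true = subst (λ b → (if b then paley-arc (vertex (c u)) (vertex (c v))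
                                    else paley-arc (vertex (c v)) (vertex (c u))) ≡ true)
        (trans (Bool.xor-comm (pushed (c v)) (pushed (c u))) e) (A-paley (c-hom h))

subcubic-pushChi : ∀ {n} (G : Graph n) → MaxDegreeAtMost G 3 → GraphPushChiAtMost G 7
subcubic-pushChi G maxDeg D orient = colouring-pushChi D c λ {u} {v} h →
  -- For an arc from `u` to `v` the sign is `false`, so `see u v` is the identity.
  subst (λ b → turn (not b) (c u) ⟶ c v) h (proper ∉⊥ ∉⊥ (trans (orient u v) (cong (_∨ arc D v u) h)))
  where
  open Colouring G maxDeg D orient
  open Good good-all

-- An oriented K₃,₃ without identifiable vertices

underlying : ∀ {n} → OrientedGraph n → Graph n
underlying D .adj u v = arc D u v ∨ arc D v u
underlying D .irrefl v rewrite loopless D v = refl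
underlying D .Graph.sym u v = Bool.∨-comm (arc D u v) (arc D v u)

-- A 4-cycle through `u`, `w`, `v`, `w′` in which `u` and `v` relate alike to `w` and oppositely to
-- `w′`. Pushing preserves the property that exactly one of the two relations is alike.
Opposed : ∀ {n} → OrientedGraph n → Fin n → Fin n → Set
Opposed D u v = ∃[ w ] ∃[ w′ ]
  ((arc D u w ≡ true × arc D v w ≡ true) ⊎ (arc D w u ≡ true × arc D w v ≡ true)) ×
  ((arc D u w′ ≡ true × arc D w′ v ≡ true) ⊎ (arc D w′ u ≡ true × arc D v w′ ≡ true))

Separated : ∀ {n} → OrientedGraph n → Fin n → Fin n → Set
Separated D u v = (arc D u v ≡ true ⊎ arc D v u ≡ true) ⊎ Opposed D u v

separated? : ∀ {n} (D : OrientedGraph n) u v → Dec (Separated D u v)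
separated? D u v = (t (arc D u v) ⊎-dec t (arc D v u)) ⊎-dec any? λ w → any? λ w′ →
  ((t (arc D u w) ×-dec t (arc D v w)) ⊎-dec (t (arc D w u) ×-dec t (arc D w v))) ×-dec
  ((t (arc D u w′) ×-dec t (arc D w′ v)) ⊎-dec (t (arc D w′ u) ×-dec t (arc D v w′)))
  where
  t : ∀ b → Dec (b ≡ true)
  t b = b Bool.≟ true

module _ {n m} {D : OrientedGraph n} {H : OrientedGraph m} {S : Fin n → Bool} {φ : Fin n → Fin m}
         (hom : IsHom (pushArc S (arc D)) H φ) where

  -- Both directions are recorded, with `noOpp` giving the absent one, so that arcs with the same
  -- image ends can be compared as Booleans.
  arc-image : ∀ {u v} → arc D u v ≡ true →
    arc H (φ u) (φ v) ≡ not (S u xor S v) × arc H (φ v) (φ u) ≡ S u xor S v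
  arc-image {u} {v} h with S u | S v | hom u v | hom v u
  ... | false | false | f | _ = f h , noOpp H _ _ (f h)
  ... | true  | true  | f | _ = f h , noOpp H _ _ (f h)
  ... | false | true  | _ | f = noOpp H _ _ (f h) , f h
  ... | true  | false | _ | f = noOpp H _ _ (f h) , f h

  arc-image-≢ : ∀ {u v} → arc D u v ≡ true → φ u ≢ φ v
  arc-image-≢ h e with arc-image h
  ... | f , g rewrite e = Bool.not-¬ (trans (sym f) g) refl

  -- If φ u = φ v, then w forces u and v to be pushed alike, and w′ forces them to be pushed differently.
  separated-image-≢ : ∀ {u v} → Separated D u v → φ u ≢ φ v
  separated-image-≢ (inj₁ (inj₁ h)) e = arc-image-≢ h e
  separated-image-≢ (inj₁ (inj₂ h)) e = arc-image-≢ h (sym e)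
  separated-image-≢ {u} {v} (inj₂ (w , w′ , like , unlike)) e = unlike-pushed unlike (like-pushed like)
    where
    like-pushed : (arc D u w ≡ true × arc D v w ≡ true) ⊎ (arc D w u ≡ true × arc D w v ≡ true) → S u ≡ S v
    like-pushed (inj₁ (h , k)) with arc-image h | arc-image k
    ... | f , _ | g , _ rewrite e = xor-cancelʳ (Bool.not-injective (trans (sym f) g))
      where
      xor-cancelʳ : ∀ {a b c} → a xor c ≡ b xor c → a ≡ b
      xor-cancelʳ {true} {true} _ = refl
      xor-cancelʳ {false} {false} _ = refl
      xor-cancelʳ {true} {false} {true} ()
      xor-cancelʳ {true} {false} {false} ()
      xor-cancelʳ {false} {true} {true} ()
      xor-cancelʳ {false} {true} {false} ()
    like-pushed (inj₂ (h , k)) with arc-image h | arc-image k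
    ... | f , _ | g , _ rewrite e = xor-cancelˡ (S w) (Bool.not-injective (trans (sym f) g))
      where
      xor-cancelˡ : ∀ a {b c} → a xor b ≡ a xor c → b ≡ c
      xor-cancelˡ true h = Bool.not-injective h
      xor-cancelˡ false h = h
    unlike-pushed : (arc D u w′ ≡ true × arc D w′ v ≡ true) ⊎ (arc D w′ u ≡ true × arc D v w′ ≡ true) → S u ≢ S v
    unlike-pushed (inj₁ (h , k)) q with arc-image h | arc-image k
    ... | f , _ | _ , g rewrite e | q = Bool.not-¬ (Bool.xor-comm (S w′) (S v)) (trans (sym g) f)
    unlike-pushed (inj₂ (h , k)) q with arc-image h | arc-image k
    ... | _ , f | g , _ rewrite e | q = Bool.not-¬ (Bool.xor-comm (S w′) (S v)) (trans (sym f) g)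

-- K₃,₃ with parts {0,1,2}, {3,4,5}: the bipartite sign matrix has rows +++, ++−, +−+, where + is an arc
-- from the first part to the second. No two rows and no two columns are proportional.
K₃₃-arc : Fin 6 → Fin 6 → Bool
K₃₃-arc u v = lookup (lookup matrix u) v
  where
  ○ = false
  ● = true
  matrix : Vec (Vec Bool 6) 6
  matrix = (○ ∷ ○ ∷ ○ ∷ ● ∷ ● ∷ ● ∷ [])
         ∷ (○ ∷ ○ ∷ ○ ∷ ● ∷ ● ∷ ○ ∷ [])
         ∷ (○ ∷ ○ ∷ ○ ∷ ● ∷ ○ ∷ ● ∷ [])
         ∷ (○ ∷ ○ ∷ ○ ∷ ○ ∷ ○ ∷ ○ ∷ [])
         ∷ (○ ∷ ○ ∷ ● ∷ ○ ∷ ○ ∷ ○ ∷ [])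
         ∷ (○ ∷ ● ∷ ○ ∷ ○ ∷ ○ ∷ ○ ∷ [])
         ∷ []

K₃₃-oriented : OrientedGraph 6
K₃₃-oriented .arc = K₃₃-arc
K₃₃-oriented .loopless = from-yes (all? λ v → K₃₃-arc v v Bool.≟ false)
K₃₃-oriented .noOpp = from-yes (all? λ u → all? λ v → (K₃₃-arc u v Bool.≟ true) →-dec (K₃₃-arc v u Bool.≟ false))

K₃₃ : Graph 6
K₃₃ = underlying K₃₃-oriented

K₃₃-connected : Connected K₃₃
K₃₃-connected u v with short u v
  where
  -- Distances are at most 2; for `u = v` the walk goes to a neighbour and back.
  short : ∀ u v → adj K₃₃ u v ≡ true ⊎ ∃[ w ] adj K₃₃ u w ≡ true × adj K₃₃ w v ≡ true
  short = from-yes (all? λ u → all? λ v → (adj K₃₃ u v Bool.≟ true) ⊎-dec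
    any? λ w → (adj K₃₃ u w Bool.≟ true) ×-dec (adj K₃₃ w v Bool.≟ true))
... | inj₁ a = step a here
... | inj₂ (w , a , b) = step a (step b here)

K₃₃-maxDegree : MaxDegree K₃₃ 3
K₃₃-maxDegree = from-yes (all? λ v → degree K₃₃ v ≤? 3) , zero , refl

K₃₃-clique : ∀ u v → u Fin.< v → Separated K₃₃-oriented u v
K₃₃-clique = from-yes (all? λ u → all? λ v → (u Fin.<? v) →-dec separated? K₃₃-oriented u v)

K₃₃-pushChi : ¬ PushChiAtMost K₃₃-oriented 5
K₃₃-pushChi (m , m≤5 , H , φ , S , hom) with pigeonhole (s≤s m≤5) φ
... | u , v , u<v , e = separated-image-≢ {D = K₃₃-oriented} {H} {S} {φ} hom (K₃₃-clique u v u<v) e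

theorem4 : (∃ λ n → Σ (Graph n) λ G → Connected G × MaxDegree G 3 × GraphPushChiAtLeast G 6)
    × (∀ n (G : Graph n) → Connected G → MaxDegree G 3 → MaxDegreeAtMost G 3)
    × (∀ n (G : Graph n) → MaxDegreeAtMost G 3 → GraphPushChiAtMost G 7)
theorem4 =
    (6 , K₃₃ , K₃₃-connected , K₃₃-maxDegree , K₃₃-oriented , (λ _ _ → refl) , K₃₃-pushChi)
  , (λ _ _ _ → proj₁)
  , λ _ → subcubic-pushChi
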